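{- For $n\geq 0$ let $$A_n(r,b)=\sum_{w\in\mathscr{D}_n} r^{C_r(w)}\,b^{C_b(w)},$$ where $C_r(w)$ and $C_b(w)$ are the numbers of red, respectively blue, edges of the Hasse diagram of $(\mathscr{D}_n,\leq)$ arriving at $w$. Then for every $n\geq 1$, $$A_n(r,rb)=r^{n-1}A_n(1/r,b/r).$$
   Context: A Dyck path of size $n\geq 0$ is a word of length $2n$ in the letters $0,1$ with $n$ letters $1$ and $n$ letters $0$ such that every prefix contains at least as many $1$'s as $0$'s (the height after a prefix is its number of $1$'s minus its number of $0$'s). Let $\mathscr{D}_n$ be the set of Dyck paths of size $n$. A subpath of a Dyck path $w$ is a non-empty sequence $x$ of consecutive letters of $w$ that starts and ends at the same height and stays strictly above that height in between. A subpath $x$ is movable in $w$ if it is immediately preceded in $w$ by the letter $0$ and either $x$ ends at the last letter of $w$ or $x$ is immediately followed in $w$ by the letter $1$. For a movable subpath $x$, let $N=N(w,x)\geq 1$ be the number of consecutive letters $0$ just before $x$, so $w=a\,0^{N}\,x\,b$ where $a$ does not end with $0$; for $1\leq i\leq N$ let $M(w,x,i)=a\,0^{N-i}\,x\,0^{i}\,b\in\mathscr{D}_n$. Let $\Gamma_n$ be the directed graph on $\mathscr{D}_n$ with edges $w\to M(w,x,i)$ for all movable $x$ in $w$ and all $1\leq i\leq N(w,x)$. The dexter order is: $u\leq v$ if and only if there is a directed path (possibly of length $0$) from $u$ to $v$ in $\Gamma_n$. This is a partial order whose cover relations are exactly the edges of $\Gamma_n$, so $\Gamma_n$ is its Hasse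 diagram. Coloring: an edge $w\to M(w,x,i)$ is red if the subpath $x$ is slid to its highest possible position, i.e. $i=N(w,x)$; all other edges are blue. The edge $w\to w'$ is said to arrive at (be incoming at) $w'$. -}

module Defs where

open import Algebra.Bundles using (CommutativeRing)
open import Data.Digit using (Bit; 0b; 1b)
open import Data.Fin.Properties using () renaming (_≟_ to _≟ᵇ_)
open import Data.List.Base using (List; []; _∷_; _++_; map; filter; length; replicate; inits; head; last; foldr)
open import Data.List.Properties using (≡-dec; length-replicate)
open import Data.List.Relation.Unary.All using (All; all?)
open import Data.Maybe.Base using (Maybe; just)
import Data.Maybe.Properties as Maybe
open import Data.Nat.Base using (ℕ; zero; suc; _*_; _∸_; _≤_; _<_; s≤s)
open import Data.Nat.Properties using (_≟_; _≤?_; _<?_; anyUpTo?)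
open import Data.Product.Base using (Σ-syntax; ∃-syntax; _×_; _,_)
open import Data.Sum.Base using (_⊎_; inj₁; inj₂)
open import Relation.Binary.Definitions using (DecidableEquality)
open import Relation.Binary.PropositionalEquality using (_≡_; _≢_; refl; sym; cong; subst)
open import Relation.Nullary using (Dec; ¬_)
open import Relation.Nullary.Decidable using (map′; _×-dec_; _⊎-dec_; ¬?)

Word : Set
Word = List Bit

_≟ʷ_ : DecidableEquality Word
_≟ʷ_ = ≡-dec _≟ᵇ_

_≟ᵐ_ : DecidableEquality (Maybe Bit)
_≟ᵐ_ = Maybe.≡-dec _≟ᵇ_

zeros ones : Word → ℕ
zeros w = length (filter (_≟ᵇ 0b) w)
ones  w = length (filter (_≟ᵇ 1b) w)

------------------------------------------------------------------------
-- Dyck paths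

IsDyck : ℕ → Word → Set
IsDyck n w = ones w ≡ n × zeros w ≡ n × All (λ p → zeros p ≤ ones p) (inits w)

isDyck? : ∀ n w → Dec (IsDyck n w)
isDyck? n w = ones w ≟ n ×-dec zeros w ≟ n ×-dec all? (λ p → zeros p ≤? ones p) (inits w)

words : ℕ → List Word
words zero    = [] ∷ []
words (suc m) = map (0b ∷_) (words m) ++ map (1b ∷_) (words m)

dyckPaths : ℕ → List Word
dyckPaths n = filter (isDyck? n) (words (2 * n))

------------------------------------------------------------------------
-- Movable subpaths and the graph Γₙ

-- Heights along a subpath are compared with its own starting height, so the
-- condition depends only on the factor x and not on where it occurs.  The
-- list inits x contains both [] and x, which are the two ends of the subpath.
IsSubpath : Word → Set
IsSubpath x = x ≢ [] × ones x ≡ zeros x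
            × All (λ p → p ≡ [] ⊎ p ≡ x ⊎ zeros p < ones p) (inits x)

isSubpath? : ∀ x → Dec (IsSubpath x)
isSubpath? x = ¬? (x ≟ʷ []) ×-dec ones x ≟ zeros x
  ×-dec all? (λ p → p ≟ʷ [] ⊎-dec p ≟ʷ x ⊎-dec zeros p <? ones p) (inits x)

-- An occurrence of a movable subpath x in w = a 0ᴺ x b.
record Movable (w : Word) : Set where
  field
    a           : Word
    N           : ℕ
    x           : Word
    b           : Word
    split       : w ≡ a ++ replicate N 0b ++ x ++ b
    N-maximal   : last a ≢ just 0b
    preceded    : 1 ≤ N
    subpath     : IsSubpath x
    followed    : b ≡ [] ⊎ head b ≡ just 1b

slide : Word → ℕ → Word → Word → ℕ → Word
slide a N x b i = a ++ replicate (N ∸ i) 0b ++ x ++ replicate i 0b ++ b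

M : ∀ {w} → Movable w → ℕ → Word
M m i = slide a N x b i where open Movable m

-- Γₙ is the Hasse diagram of the dexter order, the reflexive transitive
-- closure of Edge on Dyck paths of size n.
Edge : Word → Word → Set
Edge w w′ = Σ[ m ∈ Movable w ] ∃[ i ] (i ≤ Movable.N m × 1 ≤ i × w′ ≡ M m i)

RedEdge : Word → Word → Set
RedEdge w w′ = Σ[ m ∈ Movable w ] w′ ≡ M m (Movable.N m)

BlueEdge : Word → Word → Set
BlueEdge w w′ = Edge w w′ × ¬ RedEdge w w′

------------------------------------------------------------------------
-- Decidability of the edge relations

private
  factor? : {P : Word → Word → Set} → (∀ p s → Dec (P p s)) →
            ∀ w → Dec (∃[ p ] ∃[ s ] (w ≡ p ++ s × P p s))
  factor? P? [] = map′ (λ q → [] , [] , refl , q)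
                       (λ { ([] , [] , refl , q) → q }) (P? [] [])
  factor? {P} P? (c ∷ w) =
    map′ to from (P? [] (c ∷ w) ⊎-dec factor? (λ p s → P? (c ∷ p) s) w)
    where
    to : P [] (c ∷ w) ⊎ (∃[ p ] ∃[ s ] (w ≡ p ++ s × P (c ∷ p) s)) →
         ∃[ p ] ∃[ s ] (c ∷ w ≡ p ++ s × P p s)
    to (inj₁ q)                  = [] , c ∷ w , refl , q
    to (inj₂ (p , s , refl , q)) = c ∷ p , s , refl , q
    from : ∃[ p ] ∃[ s ] (c ∷ w ≡ p ++ s × P p s) →
           P [] (c ∷ w) ⊎ (∃[ p ] ∃[ s ] (w ≡ p ++ s × P (c ∷ p) s))
    from ([]    , s , refl , q) = inj₁ q
    from (_ ∷ p , s , refl , q) = inj₂ (p , s , refl , q)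

  movable? : {Q : Word → ℕ → Word → Word → Set} → (∀ a N x b → Dec (Q a N x b)) →
             ∀ w → Dec (Σ[ m ∈ Movable w ] (let open Movable m in Q a N x b))
  movable? {Q} Q? w = map′ to from
    (factor? (λ a r → factor? (λ z r′ → factor? (λ x b → cond? a z x b) r′) r) w)
    where
    Cond : Word → Word → Word → Word → Set
    Cond a z x b = z ≡ replicate (length z) 0b × last a ≢ just 0b × 1 ≤ length z
                 × IsSubpath x × (b ≡ [] ⊎ head b ≡ just 1b) × Q a (length z) x b
    cond? : ∀ a z x b → Dec (Cond a z x b)
    cond? a z x b = z ≟ʷ replicate (length z) 0b ×-dec ¬? (last a ≟ᵐ just 0b)
      ×-dec 1 ≤? length z ×-dec isSubpath? x
      ×-dec (b ≟ʷ [] ⊎-dec head b ≟ᵐ just 1b) ×-dec Q? a (length z) x b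
    Found : Set
    Found = ∃[ a ] ∃[ r ] (w ≡ a ++ r × ∃[ z ] ∃[ r′ ] (r ≡ z ++ r′ ×
              ∃[ x ] ∃[ b ] (r′ ≡ x ++ b × Cond a z x b)))
    to : Found → Σ[ m ∈ Movable w ] (let open Movable m in Q a N x b)
    to (a , _ , refl , z , _ , refl , x , b , refl , z≡ , max , pre , sub , fol , q) =
      record { a = a ; N = length z ; x = x ; b = b
             ; split = cong (λ y → a ++ y ++ x ++ b) z≡
             ; N-maximal = max ; preceded = pre ; subpath = sub ; followed = fol } , q
    from : Σ[ m ∈ Movable w ] (let open Movable m in Q a N x b) → Found
    from (m , q) =
      a , _ , split , replicate N 0b , _ , refl , x , b , refl
        , cong (λ k → replicate k 0b) (sym len) , N-maximal
        , subst (1 ≤_) (sym len) preceded , subpath , followed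
        , subst (λ k → Q a k x b) (sym len) q
      where
      open Movable m
      len : length (replicate N 0b) ≡ N
      len = length-replicate N

edge? : ∀ w w′ → Dec (Edge w w′)
edge? w w′ = movable? {Q = λ a N x b → ∃[ i ] (i ≤ N × 1 ≤ i × w′ ≡ slide a N x b i)}
  (λ a N x b → map′ (λ { (i , s≤s i≤N , q) → i , i≤N , q })
                    (λ { (i , i≤N , q) → i , s≤s i≤N , q })
                    (anyUpTo? (λ i → 1 ≤? i ×-dec w′ ≟ʷ slide a N x b i) (suc N)))
  w

redEdge? : ∀ w w′ → Dec (RedEdge w w′)
redEdge? w w′ = movable? {Q = λ a N x b → w′ ≡ slide a N x b N}
  (λ a N x b → w′ ≟ʷ slide a N x b N) w

blueEdge? : ∀ w w′ → Dec (BlueEdge w w′)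
blueEdge? w w′ = edge? w w′ ×-dec ¬? (redEdge? w w′)

------------------------------------------------------------------------
-- The generating polynomial

-- Distinct pairs (x , i) give distinct targets M(w,x,i), so incoming edges
-- at w are counted by their sources.
Cr Cb : ℕ → Word → ℕ
Cr n w = length (filter (λ u → redEdge?  u w) (dyckPaths n))
Cb n w = length (filter (λ u → blueEdge? u w) (dyckPaths n))

module _ {c ℓ} (R : CommutativeRing c ℓ) where
  open CommutativeRing R using (Carrier; 0#; semiring) renaming (_+_ to _⊕_; _*_ to _⊗_)
  open import Algebra.Properties.Semiring.Exp semiring using (_^_)

  -- The value of the polynomial Aₙ ∈ ℕ[r, b] at a point of R.
  A : ℕ → Carrier → Carrier → Carrier
  A n r b = foldr _⊕_ 0# (map (λ w → (r ^ Cr n w) ⊗ (b ^ Cb n w)) (dyckPaths n))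

-- An edge arriving at w is determined by a subpath x of w followed by the
-- letter 0, and it is red when x is not preceded by 0.  Reading w as a plane
-- forest, x is the last child of its parent, so incoming edges correspond to
-- nodes with a child, and blue ones to nodes with at least two children.
-- Rotating right subtrees along the chains of left children of the associated
-- binary tree makes these the nodes with a left child and the nodes with two
-- children.  Mirroring the binary tree preserves the latter; and since the n - 1
-- edges of the tree are left or right edges, it replaces the in-degree d of w
-- by n - 1 - d.  This is the claimed symmetry of the generating polynomial.

module Submission where

open import Defs
open import Level using (Level)
open import Algebra.Bundles using (CommutativeRing)
open import Data.Nat.Base using (ℕ; _≤_; _∸_)
open import Algebra.Properties.Semiring.Exp using ()

open import Data.Bool.Base using (Bool; true; false; if_then_else_; _∧_; _∨_)
open import Data.Bool.Properties using (∨-zeroʳ) renaming (_≟_ to _≟ᵒ_)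
open import Data.Digit using (Bit)
open import Data.Fin.Base using (Fin; zero; suc)
open import Data.Fin.Properties using (injective⇒≤) renaming (_≟_ to _≟ᵇ_)
open import Data.List.Base using
  (List; []; _∷_; _++_; map; filter; foldr; length; lookup; replicate; inits; head; last)
open import Data.List.Properties using
  (filter-++; length-++; length-map; ++-assoc; ++-cancelˡ; ∷-injectiveˡ; ∷-injectiveʳ;
    ++-identityʳ; map-∘; map-id-local)
open import Data.List.Membership.Propositional using (_∈_)
open import Data.List.Membership.Propositional.Properties using
  (∈-++⁺ʳ; ∈-++⁺ˡ; ∈-++⁻; ∈-filter⁺; ∈-filter⁻; ∈-lookup; ∈-map⁺; ∈-map⁻)
open import Data.List.Membership.Propositional.Properties.WithK using (unique∧set⇒bag)
import Data.List.Membership.Setoid.Properties as SetoidMembership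
open import Data.List.Relation.Binary.BagAndSetEquality using (∼bag⇒↭)
open import Data.List.Relation.Binary.Permutation.Propositional using (_↭_; ↭⇒↭ₛ′)
open import Data.List.Relation.Binary.Permutation.Propositional.Properties using (map⁺)
open import Data.List.Relation.Unary.All as All using (All; []; _∷_)
import Data.List.Relation.Unary.All.Properties as All
open import Data.List.Relation.Unary.AllPairs using ([]; _∷_)
open import Data.List.Relation.Unary.Any using (here; there; index)
open import Data.List.Relation.Unary.Unique.Propositional using (Unique)
import Data.List.Relation.Unary.Unique.Propositional.Properties as Unique
open import Data.Maybe.Base using (just)
import Data.Nat.Base as ℕ
open import Data.Nat.Base using (zero; suc; _+_; _<_; z≤n; s≤s; s≤s⁻¹)
open import Data.Nat.Properties using
  (+-assoc; +-comm; +-identityʳ; +-suc; m+n∸n≡m; m∸n+n≡m; m≤n+m; n∸n≡0; suc-injective;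
    ≤-antisym; ≤-refl)
open import Data.Nat.Tactic.RingSolver using (solve-∀)
open import Data.Product.Base using (Σ-syntax; ∃-syntax; _×_; _,_; proj₁; proj₂)
open import Data.Sum.Base using (_⊎_; inj₁; inj₂)
open import Function.Base using (_∘_; case_of_)
open import Function.Bundles using (mk⇔)
open import Relation.Binary.PropositionalEquality using
  (_≡_; _≢_; refl; sym; trans; cong; cong₂; subst; setoid; module ≡-Reasoning)
open import Relation.Nullary using (¬_; Dec; does; yes; contradiction)

-- Unlike 0b and 1b, these can be matched on.
pattern 𝟎 = zero
pattern 𝟏 = suc zero

private
  variable
    h k m n : ℕ
    c e : Bool
    p q u v w y z : Word

-- Lattice paths

-- The prefix condition on Dyck words is built into the index: `down` needs a positive height.
-- Inductions on paths thus avoid `inits`.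
data Path : ℕ → Word → ℕ → Set where
  []   : ∀ {h} → Path h [] h
  up   : ∀ {h w k} → Path (suc h) w k → Path h (𝟏 ∷ w) k
  down : ∀ {h w k} → Path h w k → Path (suc h) (𝟎 ∷ w) k

path-height : Path h w k → h + ones w ≡ k + zeros w
path-height []               = refl
path-height (up {h} {w} r)   = trans (+-suc h (ones w)) (path-height r)
path-height (down {h} {w} {k} r) = trans (cong suc (path-height r)) (sym (+-suc k (zeros w)))

path-nonneg : Path h w k → All (λ p → zeros p ≤ h + ones p) (inits w)
path-nonneg []       = z≤n ∷ []
path-nonneg (up {h} r) = z≤n ∷ All.map⁺ (All.map (λ {p} → subst (zeros p ≤_) (sym (+-suc h (ones p)))) (path-nonneg r))
path-nonneg (down r) = z≤n ∷ All.map⁺ (All.map s≤s (path-nonneg r))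

nonneg-path : ∀ h w k → h + ones w ≡ k + zeros w →
              All (λ p → zeros p ≤ h + ones p) (inits w) → Path h w k
nonneg-path h [] k eq _ with refl ← trans (sym (+-identityʳ h)) (trans eq (+-identityʳ k)) = []
nonneg-path h (𝟏 ∷ w) k eq (_ ∷ ps) =
  up (nonneg-path (suc h) w k (trans (sym (+-suc h (ones w))) eq)
       (All.map (λ {p} → subst (zeros p ≤_) (+-suc h (ones p))) (All.map⁻ ps)))
-- The one-letter prefix `0` already violates the bound.
nonneg-path zero (𝟎 ∷ w) k eq (_ ∷ () ∷ _)
nonneg-path (suc h) (𝟎 ∷ w) k eq (_ ∷ ps) =
  down (nonneg-path h w k (suc-injective (trans eq (+-suc k (zeros w)))) (All.map s≤s⁻¹ (All.map⁻ ps)))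

path-++⁺ : Path h v k → Path k w m → Path h (v ++ w) m
path-++⁺ []       s = s
path-++⁺ (up r)   s = up (path-++⁺ r s)
path-++⁺ (down r) s = down (path-++⁺ r s)

path-++⁻ : ∀ v → Path h (v ++ w) m → ∃[ k ] (Path h v k × Path k w m)
path-++⁻ [] r = _ , [] , r
path-++⁻ (𝟏 ∷ v) (up r) with _ , s , t ← path-++⁻ v r = _ , up s , t
path-++⁻ (𝟎 ∷ v) (down r) with _ , s , t ← path-++⁻ v r = _ , down s , t

path-end-unique : Path h w k → Path h w m → k ≡ m
path-end-unique []       []       = refl
path-end-unique (up r)   (up s)   = path-end-unique r s
path-end-unique (down r) (down s) = path-end-unique r s

path-lift : ∀ j → Path h w k → Path (h + j) w (k + j)
path-lift j []       = []
path-lift j (up r)   = up (path-lift j r)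
path-lift j (down r) = down (path-lift j r)

isDyck⇒path : IsDyck n w → Path 0 w 0
isDyck⇒path {w = w} (o , z , ps) = nonneg-path 0 w 0 (trans o (sym z)) ps

path⇒isDyck : ones w ≡ n → Path 0 w 0 → IsDyck n w
path⇒isDyck o r = o , trans (sym (path-height r)) o , path-nonneg r

-- Paths reaching height 0 for the first time at their end

-- Both steps start at positive height, so 0 is reached only at the end. At `h = 1` these are the
-- words that complete an opening letter `1` to a subpath.
data FirstReturn : ℕ → Word → Set where
  []   : FirstReturn 0 []
  up   : ∀ {h y} → FirstReturn (suc (suc h)) y → FirstReturn (suc h) (𝟏 ∷ y)
  down : ∀ {h y} → FirstReturn h y → FirstReturn (suc h) (𝟎 ∷ y)

firstReturn⇒path : FirstReturn h y → Path h y 0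
firstReturn⇒path []       = []
firstReturn⇒path (up r)   = up (firstReturn⇒path r)
firstReturn⇒path (down r) = down (firstReturn⇒path r)

-- The letters read so far determine the height, and a word in `FirstReturn` stops as soon as it is
-- 0; no such word is a proper prefix of another.
firstReturn-unique : ∀ {s t} → FirstReturn h y → FirstReturn h z → y ++ s ≡ z ++ t → y ≡ z × s ≡ t
firstReturn-unique []       []        eq = refl , eq
firstReturn-unique (up r)   (up r′)   eq with refl , eq′ ← firstReturn-unique r r′ (∷-injectiveʳ eq) = refl , eq′
firstReturn-unique (down r) (down r′) eq with refl , eq′ ← firstReturn-unique r r′ (∷-injectiveʳ eq) = refl , eq′
firstReturn-unique (up r)   (down r′) ()
firstReturn-unique (down r) (up r′)   ()

firstReturn-above : FirstReturn h y → All (λ p → p ≡ y ⊎ zeros p < h + ones p) (inits y)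
firstReturn-above []   = inj₁ refl ∷ []
firstReturn-above (up {h} r) =
  inj₂ (s≤s z≤n) ∷ All.map⁺ (All.map
    (λ { (inj₁ refl) → inj₁ refl ; {p} (inj₂ l) → inj₂ (subst (zeros p <_) (cong suc (sym (+-suc h (ones p)))) l) })
    (firstReturn-above r))
firstReturn-above (down r) =
  inj₂ (s≤s z≤n) ∷ All.map⁺ (All.map (λ { (inj₁ refl) → inj₁ refl ; (inj₂ l) → inj₂ (s≤s l) }) (firstReturn-above r))

above-firstReturn : ∀ h y → h + ones y ≡ zeros y →
                    All (λ p → p ≡ y ⊎ zeros p < h + ones p) (inits y) → FirstReturn h y
-- The empty prefix is not strictly above 0, so it must be all of `y`.
above-firstReturn zero y eq (inj₁ refl ∷ _) = []
above-firstReturn zero y eq (inj₂ () ∷ _)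
above-firstReturn (suc h) [] ()
above-firstReturn (suc h) (𝟏 ∷ y) eq (_ ∷ ps) =
  up (above-firstReturn (suc (suc h)) y (trans (cong suc (sym (+-suc h (ones y)))) eq)
    (All.map (λ { (inj₁ e) → inj₁ (∷-injectiveʳ e) ; {p} (inj₂ l) → inj₂ (subst (zeros p <_) (cong suc (+-suc h (ones p))) l) }) (All.map⁻ ps)))
above-firstReturn (suc h) (𝟎 ∷ y) eq (_ ∷ ps) =
  down (above-firstReturn h y (suc-injective eq)
    (All.map (λ { (inj₁ e) → inj₁ (∷-injectiveʳ e) ; (inj₂ l) → inj₂ (s≤s⁻¹ l) }) (All.map⁻ ps)))

subpath⇒firstReturn : IsSubpath w → ∃[ y ] (w ≡ 𝟏 ∷ y × FirstReturn 1 y)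
subpath⇒firstReturn {[]} (ne , _) = contradiction refl ne
subpath⇒firstReturn {𝟎 ∷ []} (_ , () , _)
subpath⇒firstReturn {𝟎 ∷ _ ∷ _} (_ , _ , _ ∷ inj₂ (inj₂ ()) ∷ _)
subpath⇒firstReturn {𝟏 ∷ y} (_ , eq , _ ∷ ps) = y , refl ,
  above-firstReturn 1 y eq
    (All.map (λ { (inj₂ (inj₁ e)) → inj₁ (∷-injectiveʳ e) ; (inj₂ (inj₂ l)) → inj₂ l }) (All.map⁻ ps))

firstReturn⇒subpath : FirstReturn 1 y → IsSubpath (𝟏 ∷ y)
firstReturn⇒subpath r = (λ ()) , path-height (firstReturn⇒path r) ,
  inj₁ refl ∷ All.map⁺ (All.map (λ { (inj₁ refl) → inj₂ (inj₁ refl) ; (inj₂ l) → inj₂ (inj₂ l) }) (firstReturn-above r))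

-- The list of Dyck words

length≡ones+zeros : ∀ w → length w ≡ ones w + zeros w
length≡ones+zeros []       = refl
length≡ones+zeros (𝟏 ∷ w) = cong suc (length≡ones+zeros w)
length≡ones+zeros (𝟎 ∷ w) = trans (cong suc (length≡ones+zeros w)) (sym (+-suc (ones w) (zeros w)))

∈-words : ∀ w → w ∈ words (length w)
∈-words []       = here refl
∈-words (𝟎 ∷ w) = ∈-++⁺ˡ (∈-map⁺ (𝟎 ∷_) (∈-words w))
∈-words (𝟏 ∷ w) = ∈-++⁺ʳ (map (𝟎 ∷_) (words (length w))) (∈-map⁺ (𝟏 ∷_) (∈-words w))

words-unique : ∀ m → Unique (words m)
words-unique zero    = [] ∷ []
words-unique (suc m) =
  Unique.++⁺ (Unique.map⁺ ∷-injectiveʳ (words-unique m)) (Unique.map⁺ ∷-injectiveʳ (words-unique m))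
    λ (v∈0 , v∈1) → case ∈-map⁻ (𝟎 ∷_) v∈0 , ∈-map⁻ (𝟏 ∷_) v∈1 of λ
      { ((_ , _ , refl) , (_ , _ , ())) }

∈-dyckPaths⁺ : IsDyck n w → w ∈ dyckPaths n
∈-dyckPaths⁺ {n} {w} d@(o , z , _) = ∈-filter⁺ (isDyck? n)
  (subst (λ l → w ∈ words l)
    (trans (length≡ones+zeros w) (cong₂ _+_ o (trans z (sym (+-identityʳ n))))) (∈-words w)) d

∈-dyckPaths⁻ : ∀ n → w ∈ dyckPaths n → IsDyck n w
∈-dyckPaths⁻ n w∈ = proj₂ (∈-filter⁻ (isDyck? n) {xs = words (2 ℕ.* n)} w∈)

dyckPaths-unique : ∀ n → Unique (dyckPaths n)
dyckPaths-unique n = Unique.filter⁺ (isDyck? n) (words-unique (2 ℕ.* n))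

-- Incoming edges

startsZero : Word → Bool
startsZero (𝟎 ∷ _) = true
startsZero _       = false

isZero : Bit → Bool
isZero 𝟎 = true
isZero 𝟏 = false

-- The flag `e` stands for the letter before the word: true if that letter is `0`. It is the answer
-- for the empty word.
endsZero : Bool → Word → Bool
endsZero e []      = e
endsZero e (d ∷ w) = endsZero (isZero d) w

endsZero-++ : ∀ e w k → endsZero e (w ++ replicate (suc k) 𝟎) ≡ true
endsZero-++ e []      zero    = refl
endsZero-++ e []      (suc k) = endsZero-++ true [] k
endsZero-++ e (d ∷ w) k       = endsZero-++ (isZero d) w k

last⇒endsZero : ∀ e d w → last (d ∷ w) ≢ just 𝟎 → endsZero e (d ∷ w) ≡ false
last⇒endsZero e 𝟎 []      ne = contradiction refl ne
last⇒endsZero e 𝟏 []      _  = refl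
last⇒endsZero e 𝟎 (d ∷ w) ne = last⇒endsZero true d w ne
last⇒endsZero e 𝟏 (d ∷ w) ne = last⇒endsZero false d w ne

trailingZeros : ∀ (p : Word) → ∃[ a ] ∃[ k ] (p ≡ a ++ replicate k 𝟎 × last a ≢ just 𝟎)
trailingZeros [] = [] , 0 , refl , λ ()
trailingZeros (d ∷ p) with trailingZeros p
trailingZeros (d ∷ p) | a@(_ ∷ _) , k , eq , ne = d ∷ a , k , cong (d ∷_) eq , ne
trailingZeros (𝟏 ∷ p) | [] , k , eq , ne = 𝟏 ∷ [] , k , cong (𝟏 ∷_) eq , λ ()
trailingZeros (𝟎 ∷ p) | [] , k , eq , ne = [] , suc k , cong (𝟎 ∷_) eq , λ ()

leadingZeros : ∀ (s : Word) → ∃[ i ] ∃[ b ] (s ≡ replicate i 𝟎 ++ b × startsZero b ≡ false)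
leadingZeros []      = 0 , [] , refl , refl
leadingZeros (𝟏 ∷ s) = 0 , 𝟏 ∷ s , refl , refl
leadingZeros (𝟎 ∷ s) with i , b , eq , nz ← leadingZeros s = suc i , b , cong (𝟎 ∷_) eq , nz

leadingZeros-unique : ∀ i j {b b′} → startsZero b ≡ false → startsZero b′ ≡ false →
                      replicate i 𝟎 ++ b ≡ replicate j 𝟎 ++ b′ → i ≡ j × b ≡ b′
leadingZeros-unique zero    zero    _  _  eq = refl , eq
leadingZeros-unique zero    (suc j) () _  refl
leadingZeros-unique (suc i) zero    _  () refl
leadingZeros-unique (suc i) (suc j) nz nz′ eq
  with refl , eq′ ← leadingZeros-unique i j nz nz′ (∷-injectiveʳ eq) = refl , eq′

-- An edge u → w is determined by the prefix p of w before the subpath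
-- x = 1 body: x was slid past exactly the 1 + i zeros that follow it in w,
-- and the edge is red if and only if p does not end with 0.
record Arrival (w p u : Word) : Set where
  constructor slid
  field
    body        : Word
    i           : ℕ
    b           : Word
    firstReturn : FirstReturn 1 body
    maximal     : startsZero b ≡ false
    target      : w ≡ p ++ 𝟏 ∷ body ++ 𝟎 ∷ replicate i 𝟎 ++ b
    source      : u ≡ p ++ 𝟎 ∷ replicate i 𝟎 ++ 𝟏 ∷ body ++ b

-- After `p`, the first return fixes `body`; then `i` and `b` are fixed because `b` does not start
-- with `0`.
arrival-functional : Arrival w p u → Arrival w p v → u ≡ v
arrival-functional {p = p} (slid y i b r nz refl refl) (slid y′ j b′ r′ nz′ eq refl)
  with refl , eq₁ ← firstReturn-unique r r′ (∷-injectiveʳ (++-cancelˡ p _ _ eq))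
  with refl , refl ← leadingZeros-unique i j nz nz′ (∷-injectiveʳ eq₁) = refl

-- Both `p` and `q` are the longest common prefix of the two words. For an arrival, `w` has `1` and
-- `u` has `0` right after the prefix, so the prefix can be recovered from `u` and `w`.
first-difference : ∀ {A : Set} {a b : A} → a ≢ b → ∀ p q {s t s′ t′} →
                   p ++ a ∷ s ≡ q ++ a ∷ s′ → p ++ b ∷ t ≡ q ++ b ∷ t′ → p ≡ q
first-difference a≢b []      []      _  _  = refl
first-difference a≢b []      (_ ∷ _) e₁ e₂ = contradiction (trans (∷-injectiveˡ e₁) (sym (∷-injectiveˡ e₂))) a≢b
first-difference a≢b (_ ∷ _) []      e₁ e₂ = contradiction (trans (sym (∷-injectiveˡ e₁)) (∷-injectiveˡ e₂)) a≢b
first-difference a≢b (_ ∷ p) (_ ∷ q) e₁ e₂ =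
  cong₂ _∷_ (∷-injectiveˡ e₁) (first-difference a≢b p q (∷-injectiveʳ e₁) (∷-injectiveʳ e₂))

arrival-injective : Arrival w p u → Arrival w q u → p ≡ q
arrival-injective {p = p} {q = q} (slid _ _ _ _ _ refl refl) (slid _ _ _ _ _ e₁ e₂) =
  first-difference (λ ()) p q e₁ e₂

ones-++ : ∀ v w → ones (v ++ w) ≡ ones v + ones w
ones-++ v w = trans (cong length (filter-++ (_≟ᵇ 𝟏) v w)) (length-++ (filter (_≟ᵇ 𝟏) v))

path-swap : ∀ x z {b} → Path 0 x 0 → Path h (x ++ z ++ b) m → Path h (z ++ x ++ b) m
path-swap {h} x z r s
  with k , s₁ , s₂ ← path-++⁻ x s
  -- Lifted to height `h`, `x` comes back to `h`, so `z` may be read first and `x` at whatever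
  -- height `z` reaches.
  with refl ← path-end-unique (path-lift h r) s₁
  with j , t₁ , t₂ ← path-++⁻ z s₂ = path-++⁺ t₁ (path-++⁺ (path-lift j r) t₂)

ones-swap : ∀ x z {b} → ones (x ++ z ++ b) ≡ ones (z ++ x ++ b)
ones-swap x z {b} = begin
  ones (x ++ z ++ b)            ≡⟨ trans (ones-++ x (z ++ b)) (cong (ones x +_) (ones-++ z b)) ⟩
  ones x + (ones z + ones b)    ≡⟨ trans (sym (+-assoc (ones x) _ _)) (trans (cong (_+ ones b) (+-comm (ones x) (ones z))) (+-assoc (ones z) _ _)) ⟩
  ones z + (ones x + ones b)    ≡⟨ trans (ones-++ z (x ++ b)) (cong (ones z +_) (ones-++ x b)) ⟨
  ones (z ++ x ++ b)            ∎
  where open ≡-Reasoning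

arrival-isDyck : Arrival w p u → IsDyck n w → IsDyck n u
arrival-isDyck {p = p} (slid y i b r _ refl refl) d@(o , _)
  with k , s₁ , s₂ ← path-++⁻ p (isDyck⇒path d) = path⇒isDyck
    (trans (ones-++ p (zs ++ xs ++ b))
      (trans (cong (ones p +_) (sym (ones-swap xs zs {b}))) (trans (sym (ones-++ p (xs ++ zs ++ b))) o)))
    (path-++⁺ s₁ (path-swap xs zs (up (firstReturn⇒path r)) s₂))
  where
  xs zs : Word
  xs = 𝟏 ∷ y
  zs = replicate (suc i) 𝟎

replicate-+ : ∀ {A : Set} {a : A} m n → replicate (m + n) a ≡ replicate m a ++ replicate n a
replicate-+ zero    n = refl
replicate-+ (suc m) n = cong (_ ∷_) (replicate-+ m n)

followed⇒¬startsZero : ∀ {b} → b ≡ [] ⊎ head b ≡ just 𝟏 → startsZero b ≡ false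
followed⇒¬startsZero {[]}    _ = refl
followed⇒¬startsZero {𝟏 ∷ b} _ = refl
followed⇒¬startsZero {𝟎 ∷ b} (inj₁ ())
followed⇒¬startsZero {𝟎 ∷ b} (inj₂ ())

¬startsZero⇒followed : ∀ b → startsZero b ≡ false → b ≡ [] ⊎ head b ≡ just 𝟏
¬startsZero⇒followed []      _ = inj₁ refl
¬startsZero⇒followed (𝟏 ∷ b) _ = inj₂ refl
¬startsZero⇒followed (𝟎 ∷ b) ()

-- Of the `N` zeros before `x`, the `N ∸ i` that are not crossed stay in the prefix. For `i = N` the
-- prefix is `a`, which does not end with `0`: this is the red case.
movable⇒arrival : (μ : Movable u) → ∀ i → i ≤ Movable.N μ → 1 ≤ i →
                  Arrival (M μ i) (Movable.a μ ++ replicate (Movable.N μ ∸ i) 𝟎) u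
movable⇒arrival {u} μ (suc i) i≤N _
  with y , refl , r ← subpath⇒firstReturn (Movable.subpath μ) =
  slid y i b r (followed⇒¬startsZero followed) (sym (++-assoc a zs _)) (begin
    u                                                   ≡⟨ split ⟩
    a ++ replicate N 𝟎 ++ s                             ≡⟨ cong (λ l → a ++ replicate l 𝟎 ++ s) (m∸n+n≡m i≤N) ⟨
    a ++ replicate (N ∸ suc i + suc i) 𝟎 ++ s           ≡⟨ cong (λ l → a ++ l ++ s) (replicate-+ (N ∸ suc i) (suc i)) ⟩
    a ++ (zs ++ replicate (suc i) 𝟎) ++ s               ≡⟨ cong (a ++_) (++-assoc zs _ s) ⟩
    a ++ zs ++ replicate (suc i) 𝟎 ++ s                 ≡⟨ ++-assoc a zs _ ⟨
    (a ++ zs) ++ replicate (suc i) 𝟎 ++ s               ∎)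
  where
  open Movable μ
  open ≡-Reasoning
  zs s : Word
  zs = replicate (N ∸ suc i) 𝟎
  s  = x ++ b

edge⇒arrival : Edge u w → ∃[ p ] Arrival w p u
edge⇒arrival (μ , i , i≤N , 1≤i , refl) = _ , movable⇒arrival μ i i≤N 1≤i

redEdge⇒arrival : RedEdge u w → ∃[ p ] (Arrival w p u × endsZero false p ≡ false)
redEdge⇒arrival (μ , refl) = _ , movable⇒arrival μ N ≤-refl preceded ,
  (begin
    endsZero false (a ++ replicate (N ∸ N) 𝟎) ≡⟨ cong (λ l → endsZero false (a ++ replicate l 𝟎)) (n∸n≡0 N) ⟩
    endsZero false (a ++ [])                  ≡⟨ cong (endsZero false) (++-identityʳ a) ⟩
    endsZero false a                          ≡⟨ nz a N-maximal ⟩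
    false                                     ∎)
  where
  open Movable μ
  open ≡-Reasoning
  nz : ∀ a → last a ≢ just 𝟎 → endsZero false a ≡ false
  nz []      _  = refl
  nz (d ∷ a) ne = last⇒endsZero false d a ne

-- In `u` the `k` trailing zeros of the prefix and the `1 + i` crossed zeros are adjacent, and
-- together they form the maximal run before `x`.
arrival⇒movable : ∀ a k → last a ≢ just 𝟎 → (α : Arrival w (a ++ replicate k 𝟎) u) → let open Arrival α in
                  Σ[ μ ∈ Movable u ] (Movable.N μ ≡ k + suc i × w ≡ M μ (suc i))
arrival⇒movable a k ne (slid y i b r nz refl refl) = record
  { a = a ; N = k + suc i ; x = 𝟏 ∷ y ; b = b
  ; split = trans (++-assoc a (replicate k 𝟎) _) (cong (a ++_) (trans (sym (++-assoc (replicate k 𝟎) (replicate (suc i) 𝟎) _))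
      (cong (_++ 𝟏 ∷ y ++ b) (sym (replicate-+ k (suc i))))))
  ; N-maximal = ne
  ; preceded = subst (1 ≤_) (sym (+-suc k i)) (s≤s z≤n)
  ; subpath = firstReturn⇒subpath r
  ; followed = ¬startsZero⇒followed b nz } , refl ,
  trans (++-assoc a (replicate k 𝟎) _)
    (cong (λ l → a ++ replicate l 𝟎 ++ 𝟏 ∷ y ++ 𝟎 ∷ replicate i 𝟎 ++ b) (sym (m+n∸n≡m k (suc i))))

arrival⇒edge : Arrival w p u → Edge u w
arrival⇒edge {p = p} α with a , k , refl , ne ← trailingZeros p
  with μ , N≡ , eq ← arrival⇒movable a k ne α =
  μ , suc (Arrival.i α) , subst (_ ≤_) (sym N≡) (m≤n+m _ k) , s≤s z≤n , eq

arrival⇒redEdge : Arrival w p u → endsZero false p ≡ false → RedEdge u w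
arrival⇒redEdge {p = p} α nz with trailingZeros p
... | a , suc k , refl , ne = contradiction (trans (sym (endsZero-++ false a k)) nz) λ ()
... | a , zero  , refl , ne with μ , N≡ , eq ← arrival⇒movable a 0 ne α =
  μ , trans eq (cong (M μ) (sym N≡))

-- The colour false is red and true is blue, like the value of endsZero on
-- the prefix before the slid subpath.
ColouredEdge : Bool → Word → Word → Set
ColouredEdge false = RedEdge
ColouredEdge true  = BlueEdge

colouredEdge? : ∀ c u w → Dec (ColouredEdge c u w)
colouredEdge? false = redEdge?
colouredEdge? true  = blueEdge?

colouredEdge⇒arrival : ∀ c → ColouredEdge c u w → ∃[ p ] (Arrival w p u × endsZero false p ≡ c)
colouredEdge⇒arrival false = redEdge⇒arrival
colouredEdge⇒arrival true (ε , ¬red) with p , α ← edge⇒arrival ε with endsZero false p in eq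
... | true  = p , α , eq
... | false = contradiction (arrival⇒redEdge α eq) ¬red

arrival⇒colouredEdge : ∀ c → Arrival w p u → endsZero false p ≡ c → ColouredEdge c u w
arrival⇒colouredEdge false α eq = arrival⇒redEdge α eq
-- A blue edge must exclude every red edge from `u` to `w`. Such an edge would have the same prefix
-- by `arrival-injective`, but with the other value of `endsZero`.
arrival⇒colouredEdge true α eq = arrival⇒edge α , λ red →
  case redEdge⇒arrival red of λ { (q , β , nz) →
    case trans (sym eq) (trans (cong (endsZero false) (arrival-injective α β)) nz) of λ () }

-- Counting incoming edges

lookup-injective : ∀ {A : Set} {xs : List A} → Unique xs → ∀ {i j} → lookup xs i ≡ lookup xs j → i ≡ j
lookup-injective (_ ∷ _)    {zero}  {zero}  _  = refl
lookup-injective (x∉ ∷ _)   {zero}  {suc j} eq = contradiction eq (All.lookup x∉ (∈-lookup j))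
lookup-injective (x∉ ∷ _)   {suc i} {zero}  eq = contradiction (sym eq) (All.lookup x∉ (∈-lookup i))
lookup-injective (_ ∷ uniq) {suc i} {suc j} eq = cong suc (lookup-injective uniq eq)

-- Choosing a partner in `ys` for each position of `xs` gives an injection of positions: equal
-- positions mean equal partners, and a partner determines its `x`.
injective-relation⇒length-≤ : ∀ {A B : Set} {xs : List A} {ys : List B} (S : A → B → Set) → Unique xs →
                              (∀ {x} → x ∈ xs → ∃[ y ] (y ∈ ys × S x y)) →
                              (∀ {x x′ y} → S x y → S x′ y → x ≡ x′) → length xs ≤ length ys
injective-relation⇒length-≤ {B = B} {xs} {ys} S uniq total inj = injective⇒≤ {f = f} f-injective
  where
  f : Fin (length xs) → Fin (length ys)
  f i = index (proj₁ (proj₂ (total (∈-lookup {xs = xs} i))))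
  f-injective : ∀ {i j} → f i ≡ f j → i ≡ j
  f-injective {i} {j} eq with total (∈-lookup {xs = xs} i) | total (∈-lookup {xs = xs} j)
  ... | y , y∈ , s | y′ , y′∈ , s′
    with refl ← SetoidMembership.index-injective (setoid B) y∈ y′∈ eq = lookup-injective uniq (inj s s′)

-- The path q started at height h reaches height 0, and the letter after its
-- first visit there is 0.
returnsBeforeZero : ℕ → Word → Bool
returnsBeforeZero zero    q       = startsZero q
returnsBeforeZero (suc h) []      = false
returnsBeforeZero (suc h) (𝟎 ∷ q) = returnsBeforeZero h q
returnsBeforeZero (suc h) (𝟏 ∷ q) = returnsBeforeZero (suc (suc h)) q

startsSlidable : Word → Bool
startsSlidable (𝟏 ∷ q) = returnsBeforeZero 1 q
startsSlidable _       = false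

firstReturn⇒returnsBeforeZero : ∀ {s} → FirstReturn h y → returnsBeforeZero h (y ++ 𝟎 ∷ s) ≡ true
firstReturn⇒returnsBeforeZero []       = refl
firstReturn⇒returnsBeforeZero (up r)   = firstReturn⇒returnsBeforeZero r
firstReturn⇒returnsBeforeZero (down r) = firstReturn⇒returnsBeforeZero r

returnsBeforeZero⇒firstReturn : ∀ h q → returnsBeforeZero h q ≡ true →
                                ∃[ y ] ∃[ s ] (q ≡ y ++ 𝟎 ∷ s × FirstReturn h y)
returnsBeforeZero⇒firstReturn zero    (𝟎 ∷ q) eq = [] , q , refl , []
returnsBeforeZero⇒firstReturn zero    []      ()
returnsBeforeZero⇒firstReturn zero    (𝟏 ∷ q) ()
returnsBeforeZero⇒firstReturn (suc h) []      ()
returnsBeforeZero⇒firstReturn (suc h) (𝟎 ∷ q) eq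
  with y , s , refl , r ← returnsBeforeZero⇒firstReturn h q eq = 𝟎 ∷ y , s , refl , down r
returnsBeforeZero⇒firstReturn (suc h) (𝟏 ∷ q) eq
  with y , s , refl , r ← returnsBeforeZero⇒firstReturn (suc (suc h)) q eq = 𝟏 ∷ y , s , refl , up r

slidable⇒arrival : ∀ p q → startsSlidable q ≡ true → ∃[ u ] Arrival (p ++ q) p u
slidable⇒arrival p (𝟏 ∷ q) eq
  with y , s , refl , r ← returnsBeforeZero⇒firstReturn 1 q eq
  with i , b , refl , nz ← leadingZeros s = _ , slid y i b r nz refl refl

mark : Bool → List Word
mark b = if b then [] ∷ [] else []

∈-mark⁻ : ∀ b → p ∈ mark b → p ≡ [] × b ≡ true
∈-mark⁻ true (here refl) = refl , refl

-- The prefixes p of w for which w has an incoming edge of colour c with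
-- prefix p, when w is itself preceded by a 0 (e = true) or not (e = false).
marks : Bool → Bool → Word → List Word
marks c e []      = []
marks c e (d ∷ w) = mark (startsSlidable (d ∷ w) ∧ does (e ≟ᵒ c)) ++ map (d ∷_) (marks c (isZero d) w)

∧-does : ∀ {b c e} → b ∧ does (e ≟ᵒ c) ≡ true → b ≡ true × e ≡ c
∧-does {true} {c} {e} eq with yes e≡c ← e ≟ᵒ c = refl , e≡c

does-∧ : ∀ {b e} → b ≡ true → b ∧ does (e ≟ᵒ e) ≡ true
does-∧ {e = true}  refl = refl
does-∧ {e = false} refl = refl

∈-marks⁻ : ∀ c e w → p ∈ marks c e w → ∃[ q ] (w ≡ p ++ q × startsSlidable q ≡ true × endsZero e p ≡ c)
∈-marks⁻ c e (d ∷ w) p∈ with ∈-++⁻ (mark (startsSlidable (d ∷ w) ∧ does (e ≟ᵒ c))) p∈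
... | inj₁ p∈mark with refl , b ← ∈-mark⁻ _ p∈mark with s , e≡c ← ∧-does b = d ∷ w , refl , s , e≡c
... | inj₂ p∈map with p , p∈ , refl ← ∈-map⁻ (d ∷_) p∈map
                 with q , refl , s , eq ← ∈-marks⁻ c (isZero d) w p∈ = q , refl , s , eq

∈-marks⁺ : ∀ c e p q → startsSlidable q ≡ true → endsZero e p ≡ c → p ∈ marks c e (p ++ q)
∈-marks⁺ c .c [] (d ∷ q) s refl = ∈-++⁺ˡ (subst (λ b → [] ∈ mark b) (sym (does-∧ {e = c} s)) (here refl))
∈-marks⁺ c e (d ∷ p) q s eq = ∈-++⁺ʳ (mark _) (∈-map⁺ (d ∷_) (∈-marks⁺ c (isZero d) p q s eq))

mark-unique : ∀ b → Unique (mark b)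
mark-unique true  = [] ∷ []
mark-unique false = []

marks-unique : ∀ c e w → Unique (marks c e w)
marks-unique c e []      = []
marks-unique c e (d ∷ w) = Unique.++⁺ (mark-unique _) (Unique.map⁺ ∷-injectiveʳ (marks-unique c (isZero d) w))
  λ (v∈mark , v∈map) → case ∈-mark⁻ _ v∈mark , ∈-map⁻ (d ∷_) v∈map of λ { ((refl , _) , (_ , _ , ())) }

inDegree : Bool → ℕ → Word → ℕ
inDegree c n w = length (filter (λ u → colouredEdge? c u w) (dyckPaths n))

-- `Arrival w` matches sources with prefixes one to one, which gives an inequality in each
-- direction.
inDegree≡marks : ∀ c → IsDyck n w → inDegree c n w ≡ length (marks c false w)
inDegree≡marks {n} {w} c d = ≤-antisym
  (injective-relation⇒length-≤ (λ u p → Arrival w p u) (Unique.filter⁺ (λ u → colouredEdge? c u w) (dyckPaths-unique n))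
    source⇒mark arrival-functional)
  (injective-relation⇒length-≤ (Arrival w) (marks-unique c false w) mark⇒source arrival-injective)
  where
  source⇒mark : u ∈ filter (λ u → colouredEdge? c u w) (dyckPaths n) → ∃[ p ] (p ∈ marks c false w × Arrival w p u)
  source⇒mark u∈
    with p , α , eq ← colouredEdge⇒arrival c (proj₂ (∈-filter⁻ (λ u → colouredEdge? c u w) {xs = dyckPaths n} u∈)) =
    p , subst (λ w → p ∈ marks c false w) (sym (Arrival.target α))
          (∈-marks⁺ c false p _ (firstReturn⇒returnsBeforeZero (Arrival.firstReturn α)) eq) , α
  mark⇒source : p ∈ marks c false w → ∃[ u ] (u ∈ filter (λ u → colouredEdge? c u w) (dyckPaths n) × Arrival w p u)
  mark⇒source {p} p∈
    with q , refl , s , eq ← ∈-marks⁻ c false w p∈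
    with u , α ← slidable⇒arrival p q s =
    u , ∈-filter⁺ (λ u → colouredEdge? c u w) (∈-dyckPaths⁺ (arrival-isDyck α d)) (arrival⇒colouredEdge c α eq) , α

-- Dyck words as plane forests, and forests as binary trees

-- Read as a forest, node C R is a root with children C followed by the
-- forest R.
data Tree : Set where
  nil  : Tree
  node : Tree → Tree → Tree

isNode : Tree → Bool
isNode nil        = false
isNode (node _ _) = true

size : Tree → ℕ
size nil        = 0
size (node l r) = suc (size l + size r)

mirror : Tree → Tree
mirror nil        = nil
mirror (node l r) = node (mirror r) (mirror l)

mirror-involutive : ∀ t → mirror (mirror t) ≡ t
mirror-involutive nil        = refl
mirror-involutive (node l r) = cong₂ node (mirror-involutive l) (mirror-involutive r)

isNode-mirror : ∀ t → isNode (mirror t) ≡ isNode t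
isNode-mirror nil        = refl
isNode-mirror (node _ _) = refl

size-mirror : ∀ t → size (mirror t) ≡ size t
size-mirror nil        = refl
size-mirror (node l r) = cong suc (trans (cong₂ _+_ (size-mirror r) (size-mirror l)) (+-comm (size r) (size l)))

encode : Tree → Word → Word
encode nil        w = w
encode (node C R) w = 𝟏 ∷ encode C (𝟎 ∷ encode R w)

encode-path : ∀ t → Path h w k → Path h (encode t w) k
encode-path nil        ρ = ρ
encode-path (node C R) ρ = up (encode-path C (down (encode-path R ρ)))

ones-encode : ∀ t w → ones (encode t w) ≡ size t + ones w
ones-encode nil        w = refl
ones-encode (node C R) w = cong suc (begin
  ones (encode C (𝟎 ∷ encode R w))   ≡⟨ ones-encode C _ ⟩
  size C + ones (encode R w)         ≡⟨ cong (size C +_) (ones-encode R w) ⟩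
  size C + (size R + ones w)         ≡⟨ +-assoc (size C) _ _ ⟨
  size C + size R + ones w           ∎)
  where open ≡-Reasoning

encode-isDyck : ∀ t → IsDyck (size t) (encode t [])
encode-isDyck t = path⇒isDyck (trans (ones-encode t []) (+-identityʳ (size t))) (encode-path t [])

-- A path from height h down to height 0 splits into h + 1 forests separated
-- by h letters 0.  On words that are not such paths the result is junk.
graft : Tree → List Tree → Tree × List Tree
graft C []       = C , []
graft C (R ∷ ts) = node C R , ts

parse : Word → Tree × List Tree
parse []      = nil , []
parse (𝟎 ∷ w) = nil , proj₁ (parse w) ∷ proj₂ (parse w)
parse (𝟏 ∷ w) = graft (proj₁ (parse w)) (proj₂ (parse w))

decode : Word → Tree
decode w = proj₁ (parse w)

encodeAll : Tree → List Tree → Word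
encodeAll t []        = encode t []
encodeAll t (t′ ∷ ts) = encode t (𝟎 ∷ encodeAll t′ ts)

encodeAll-graft : ∀ C R ts → encodeAll (node C R) ts ≡ 𝟏 ∷ encodeAll C (R ∷ ts)
encodeAll-graft C R []      = refl
encodeAll-graft C R (_ ∷ _) = refl

encodeAll-parse : Path h w 0 → length (proj₂ (parse w)) ≡ h × encodeAll (proj₁ (parse w)) (proj₂ (parse w)) ≡ w
encodeAll-parse []       = refl , refl
encodeAll-parse (down ρ) with eq , eq′ ← encodeAll-parse ρ = cong suc eq , cong (𝟎 ∷_) eq′
encodeAll-parse (up {w = w} ρ) with parse w | encodeAll-parse ρ
-- The remaining path starts one level higher, so its list of forests is nonempty and `graft` finds
-- the siblings `R` of the new root.
... | C , R ∷ ts | refl , eq′ = refl , trans (encodeAll-graft C R ts) (cong (𝟏 ∷_) eq′)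

-- The induction needs an arbitrary rest `w` that adds no tree to the current forest. For the
-- children `C` the rest begins with the closing `0`, and `R` becomes the next forest in the list.
parse-encode : ∀ t {w ts} → parse w ≡ (nil , ts) → parse (encode t w) ≡ (t , ts)
parse-encode nil        eq = eq
parse-encode (node C R) {w} {ts} eq = cong (λ x → graft (proj₁ x) (proj₂ x))
  (parse-encode C {ts = R ∷ ts} (cong (λ x → nil , proj₁ x ∷ proj₂ x) (parse-encode R eq)))

decode-encode : ∀ t → decode (encode t []) ≡ t
decode-encode t = cong proj₁ (parse-encode t refl)

encode-decode : IsDyck n w → encode (decode w) [] ≡ w
encode-decode {w = w} d with parse w | encodeAll-parse (isDyck⇒path d)
... | t , [] | _ , eq = eq

-- Along each maximal chain of left children with right subtrees R, C₁, …, Cₖ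
-- from the top, rotate turns these into C₁, …, Cₖ, R (themselves rotated).
-- In a forest a node has several children when its left child has a right
-- child; the shift turns this into the node itself having both.
attach : Tree → Tree → Tree
rotate : Tree → Tree
attach nil        r = node nil r
attach (node D C) r = node (attach D r) (rotate C)
rotate nil        = nil
rotate (node C R) = attach C (rotate R)

-- This exchanges the top two right subtrees of a left chain. Done from the bottom up in `unrotate`,
-- it carries the last right subtree to the top, which undoes `rotate`.
detach : Tree → Tree → Tree
detach nil        r = node nil r
detach (node D R) r = node (node D r) R

unrotate : Tree → Tree
unrotate nil        = nil
unrotate (node l r) = detach (unrotate l) (unrotate r)

unrotate-attach : ∀ C r → unrotate (attach C r) ≡ node C (unrotate r)
unrotate-rotate : ∀ t → unrotate (rotate t) ≡ t
unrotate-attach nil        r = refl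
unrotate-attach (node D C) r = cong₂ detach (unrotate-attach D r) (unrotate-rotate C)
unrotate-rotate nil        = refl
unrotate-rotate (node C R) = trans (unrotate-attach C (rotate R)) (cong (node C) (unrotate-rotate R))

rotate-detach : ∀ l r → rotate (detach l r) ≡ node (rotate l) (rotate r)
rotate-detach nil        r = refl
rotate-detach (node D R) r = refl

rotate-unrotate : ∀ t → rotate (unrotate t) ≡ t
rotate-unrotate nil        = refl
rotate-unrotate (node l r) =
  trans (rotate-detach (unrotate l) (unrotate r)) (cong₂ node (rotate-unrotate l) (rotate-unrotate r))

isNode-unrotate : ∀ t → isNode (unrotate t) ≡ isNode t
isNode-unrotate nil = refl
isNode-unrotate (node l r) with unrotate l
... | nil      = refl
... | node _ _ = refl

size-detach : ∀ l r → size (detach l r) ≡ suc (size l + size r)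
size-detach nil        r = refl
size-detach (node D R) r = cong (λ j → suc (suc j)) (swapʳ (size D) (size r) (size R))
  where
  swapʳ : ∀ a b c → a + b + c ≡ a + c + b
  swapʳ = solve-∀

size-unrotate : ∀ t → size (unrotate t) ≡ size t
size-unrotate nil        = refl
size-unrotate (node l r) =
  trans (size-detach (unrotate l) (unrotate r)) (cong suc (cong₂ _+_ (size-unrotate l) (size-unrotate r)))

-- The sum, over the nodes of a forest with at least one child, of f applied to
-- whether there are several children.
childWeight : (Bool → ℕ) → Tree → ℕ
childWeight f nil        = 0
childWeight f (node _ R) = f (isNode R)

parents : (Bool → ℕ) → Tree → ℕ
parents f nil        = 0
parents f (node C R) = childWeight f C + parents f C + parents f R

forkWeight : (Bool → ℕ) → Tree → Tree → ℕ
forkWeight f l r = if isNode l then f (isNode r) else 0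

forks : (Bool → ℕ) → Tree → ℕ
forks f nil        = 0
forks f (node l r) = forkWeight f l r + forks f l + forks f r

-- For nonempty `l`, the left child of the new root has right subtree `r`, so `childWeight` tests
-- `isNode r` there, just as `forkWeight` does.
parents-detach : ∀ f l r → parents f (detach l r) ≡ forkWeight f l r + parents f l + parents f r
parents-detach f nil        r = refl
parents-detach f (node D R) r =
  assoc′ (f (isNode r)) (childWeight f D) (parents f D) (parents f r) (parents f R)
  where
  assoc′ : ∀ a b c d e → a + (b + c + d) + e ≡ a + (b + c + e) + d
  assoc′ = solve-∀

parents-unrotate : ∀ f t → parents f (unrotate t) ≡ forks f t
parents-unrotate f nil        = refl
parents-unrotate f (node l r) = trans (parents-detach f (unrotate l) (unrotate r))
  (cong₂ _+_ (cong₂ _+_ (cong₂ (λ a b → if a then f b else 0) (isNode-unrotate l) (isNode-unrotate r))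
    (parents-unrotate f l)) (parents-unrotate f r))

-- Coloured in-degrees in terms of forests

indicator : Bool → Bool → ℕ
indicator c e = if does (e ≟ᵒ c) then 1 else 0

-- A forest never goes below its starting height, here positive, and ends at that height.
returnsBeforeZero-encode : ∀ t → returnsBeforeZero (suc h) (encode t w) ≡ returnsBeforeZero (suc h) w
returnsBeforeZero-encode nil        = refl
returnsBeforeZero-encode (node C R) = trans (returnsBeforeZero-encode C) (returnsBeforeZero-encode R)

-- The contribution of the last tree of the forest: its root is a mark only if
-- the forest is followed by a 0 (z = true).
lastRoot : (Bool → ℕ) → Bool → Bool → Tree → ℕ
lastRoot f e z nil        = 0
lastRoot f e z (node C R) = if z then f (isNode R ∨ e) else 0

length-marks-∷ : ∀ c e d w → length (marks c e (d ∷ w)) ≡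
  (if startsSlidable (d ∷ w) then indicator c e else 0) + length (marks c (isZero d) w)
length-marks-∷ c e d w = trans (length-++ (mark (startsSlidable (d ∷ w) ∧ does (e ≟ᵒ c))))
  (cong₂ _+_ (length-mark (startsSlidable (d ∷ w)) (does (e ≟ᵒ c))) (length-map (d ∷_) (marks c (isZero d) w)))
  where
  length-mark : ∀ a b → length (mark (a ∧ b)) ≡ (if a then if b then 1 else 0 else 0)
  length-mark false _     = refl
  length-mark true  false = refl
  length-mark true  true  = refl

-- If `R` is empty, the root of `C` is itself last. Otherwise `encode R w` starts with `1`, and the
-- last root lies in `R`, whose first root comes after a `0`.
lastRoot-node : ∀ f e C R w →
  (if startsZero (encode R w) then f e else 0) + lastRoot f true (startsZero w) R ≡ lastRoot f e (startsZero w) (node C R)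
lastRoot-node f e C nil                 w = +-identityʳ _
lastRoot-node f e C (node _ nil)        w = refl
lastRoot-node f e C (node _ (node _ _)) w = refl

-- This is the case of the children of a node, enclosed by its `1` and its `0`: the last child is
-- preceded by `0` exactly when it is not the only one.
lastRoot-followed : ∀ f t → lastRoot f false true t ≡ childWeight f t
lastRoot-followed f nil                 = refl
lastRoot-followed f (node _ nil)        = refl
lastRoot-followed f (node _ (node _ _)) = refl

lastRoot-unfollowed : ∀ f e t → lastRoot f e false t ≡ 0
lastRoot-unfollowed f e nil        = refl
lastRoot-unfollowed f e (node _ _) = refl

-- Marks inside the forest are last children and are counted at their parents; only the last root
-- depends on the context. A nonempty encoding ends with `0`, hence the flag `isNode t ∨ e` for `w`.
marks-encode : ∀ c e t w → length (marks c e (encode t w)) ≡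
  lastRoot (indicator c) e (startsZero w) t + parents (indicator c) t + length (marks c (isNode t ∨ e) w)
marks-encode c e nil w = refl
marks-encode c e (node C R) w = begin
  length (marks c e (𝟏 ∷ encode C (𝟎 ∷ encode R w)))
    ≡⟨ length-marks-∷ c e 𝟏 (encode C (𝟎 ∷ encode R w)) ⟩
  (if returnsBeforeZero 1 (encode C (𝟎 ∷ encode R w)) then f e else 0) + length (marks c false (encode C (𝟎 ∷ encode R w)))
    -- The scan skips `C` and its closing `0`, so the first root is a mark only if `encode R w`
    -- starts with `0`.
    ≡⟨ cong₂ (λ a b → (if a then f e else 0) + b) (returnsBeforeZero-encode C) (marks-encode c false C _) ⟩
  i + (lastRoot f false true C + parents f C + length (marks c (isNode C ∨ false) (𝟎 ∷ encode R w)))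
    ≡⟨ cong₂ (λ a b → i + (a + parents f C + b)) (lastRoot-followed f C) (length-marks-∷ c (isNode C ∨ false) 𝟎 (encode R w)) ⟩
  i + (childWeight f C + parents f C + length (marks c true (encode R w)))
    ≡⟨ cong (λ a → i + (childWeight f C + parents f C + a)) (marks-encode c true R w) ⟩
  i + (childWeight f C + parents f C + (lastRoot f true (startsZero w) R + parents f R + length (marks c (isNode R ∨ true) w)))
    ≡⟨ regroup i (childWeight f C) (parents f C) (lastRoot f true (startsZero w) R) (parents f R) _ ⟩
  i + lastRoot f true (startsZero w) R + (childWeight f C + parents f C + parents f R) + length (marks c (isNode R ∨ true) w)
    ≡⟨ cong₂ (λ a b → a + parents f (node C R) + length (marks c b w)) (lastRoot-node f e C R w) (∨-zeroʳ (isNode R)) ⟩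
  lastRoot f e (startsZero w) (node C R) + parents f (node C R) + length (marks c true w)
    ∎
  where
  open ≡-Reasoning
  f : Bool → ℕ
  f = indicator c
  i : ℕ
  i = if startsZero (encode R w) then f e else 0
  regroup : ∀ i a b j d m → i + (a + b + (j + d + m)) ≡ i + j + (a + b + d) + m
  regroup = solve-∀

inDegree-encode : ∀ c t → inDegree c (size t) (encode t []) ≡ parents (indicator c) t
inDegree-encode c t = begin
  inDegree c (size t) (encode t [])                                     ≡⟨ inDegree≡marks c (encode-isDyck t) ⟩
  length (marks c false (encode t []))                                  ≡⟨ marks-encode c false t [] ⟩
  lastRoot (indicator c) false false t + parents (indicator c) t + 0    ≡⟨ +-identityʳ _ ⟩
  lastRoot (indicator c) false false t + parents (indicator c) t        ≡⟨ cong (_+ parents (indicator c) t) (lastRoot-unfollowed _ false t) ⟩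
  parents (indicator c) t                                               ∎
  where open ≡-Reasoning

-- Reflection of Dyck words

word : Tree → Word
word t = encode (unrotate t) []

tree : Word → Tree
tree w = rotate (decode w)

tree-word : ∀ t → tree (word t) ≡ t
tree-word t = trans (cong rotate (decode-encode (unrotate t))) (rotate-unrotate t)

word-tree : IsDyck n w → word (tree w) ≡ w
word-tree {w = w} d = trans (cong (λ t → encode t []) (unrotate-rotate (decode w))) (encode-decode d)

word-isDyck : ∀ t → IsDyck (size t) (word t)
word-isDyck t = subst (λ n → IsDyck n (word t)) (size-unrotate t) (encode-isDyck (unrotate t))

size-tree : IsDyck n w → size (tree w) ≡ n
size-tree {w = w} d = trans (sym (proj₁ (word-isDyck (tree w)))) (trans (cong ones (word-tree d)) (proj₁ d))

reflect : Word → Word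
reflect w = word (mirror (tree w))

reflect-isDyck : IsDyck n w → IsDyck n (reflect w)
reflect-isDyck {w = w} d =
  subst (λ n → IsDyck n (reflect w)) (trans (size-mirror (tree w)) (size-tree d)) (word-isDyck (mirror (tree w)))

reflect-involutive : IsDyck n w → reflect (reflect w) ≡ w
reflect-involutive {w = w} d = trans (cong (word ∘ mirror) (tree-word (mirror (tree w))))
  (trans (cong word (mirror-involutive (tree w))) (word-tree d))

reflect-permutes : ∀ n → map reflect (dyckPaths n) ↭ dyckPaths n
reflect-permutes n = ∼bag⇒↭ (unique∧set⇒bag
  -- `reflect` is an involution on Dyck words only, so uniqueness is pulled back from the list
  -- reflected twice.
  (Unique.map⁻ {f = reflect} (subst Unique (sym reflect²) (dyckPaths-unique n))) (dyckPaths-unique n)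
  (mk⇔ (λ v∈ → case ∈-map⁻ reflect v∈ of λ { (w , w∈ , refl) → ∈-dyckPaths⁺ (reflect-isDyck (∈-dyckPaths⁻ n w∈)) })
       (λ w∈ → let d = ∈-dyckPaths⁻ n w∈ in
         subst (_∈ map reflect (dyckPaths n)) (reflect-involutive d) (∈-map⁺ reflect (∈-dyckPaths⁺ (reflect-isDyck d))))))
  where
  reflect² : map reflect (map reflect (dyckPaths n)) ≡ dyckPaths n
  reflect² = trans (sym (map-∘ (dyckPaths n)))
    (map-id-local (All.tabulate (λ w∈ → reflect-involutive (∈-dyckPaths⁻ n w∈))))

-- In-degrees under reflection

reds blues : Tree → ℕ
reds  = forks (indicator false)
blues = forks (indicator true)

inDegree-word : ∀ c t → inDegree c (size t) (word t) ≡ forks (indicator c) t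
inDegree-word c t = trans (cong (λ n → inDegree c n (word t)) (sym (size-unrotate t)))
  (trans (inDegree-encode c (unrotate t)) (parents-unrotate (indicator c) t))

inDegree-tree : ∀ c → IsDyck n w → inDegree c n w ≡ forks (indicator c) (tree w)
inDegree-tree {w = w} c d = trans (sym (cong₂ (inDegree c) (size-tree d) (word-tree d))) (inDegree-word c (tree w))

inDegree-reflect : ∀ c → IsDyck n w → inDegree c n (reflect w) ≡ forks (indicator c) (mirror (tree w))
inDegree-reflect {w = w} c d =
  trans (inDegree-tree c (reflect-isDyck d)) (cong (forks (indicator c)) (tree-word (mirror (tree w))))

-- With `indicator true` a node counts exactly when it has both children, a condition symmetric in
-- left and right.
blues-mirror : ∀ t → blues (mirror t) ≡ blues t
blues-mirror nil = refl
blues-mirror (node l r) = begin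
  G (mirror r) (mirror l) + blues (mirror r) + blues (mirror l)
    ≡⟨ cong₂ _+_ (cong₂ _+_ (weight l r) (blues-mirror r)) (blues-mirror l) ⟩
  G l r + blues r + blues l
    ≡⟨ swapʳ (G l r) (blues r) (blues l) ⟩
  G l r + blues l + blues r  ∎
  where
  open ≡-Reasoning
  G : Tree → Tree → ℕ
  G = forkWeight (indicator true)
  weight : ∀ l r → G (mirror r) (mirror l) ≡ G l r
  weight nil        nil        = refl
  weight nil        (node _ _) = refl
  weight (node _ _) nil        = refl
  weight (node _ _) (node _ _) = refl
  swapʳ : ∀ a b c → a + b + c ≡ a + c + b
  swapʳ = solve-∀

-- The two summands count the left and the right edges of t.
forks+forks-mirror : ∀ t → (reds t + blues t) + (reds (mirror t) + blues (mirror t)) ≡ size t ∸ 1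
forks+forks-mirror nil        = refl
forks+forks-mirror (node l r) = begin
  (F l r + reds l + reds r + (G l r + blues l + blues r)) +
  (F r′ l′ + reds r′ + reds l′ + (G r′ l′ + blues r′ + blues l′))
    ≡⟨ regroup (F l r) (reds l) (reds r) (G l r) (blues l) (blues r)
               (F r′ l′) (reds r′) (reds l′) (G r′ l′) (blues r′) (blues l′) ⟩
  (F l r + G l r + (reds l + blues l + (reds l′ + blues l′))) +
  (F r′ l′ + G r′ l′ + (reds r + blues r + (reds r′ + blues r′)))
    -- At each node, red and blue together test for a left child; in the mirror image they test for
    -- a right child.
    ≡⟨ cong₂ _+_ (cong₂ _+_ (weights l r) (forks+forks-mirror l))
                 (cong₂ _+_ (trans (weights r′ l′) (cong (λ b → if b then 1 else 0) (isNode-mirror r))) (forks+forks-mirror r)) ⟩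
  ((if isNode l then 1 else 0) + (size l ∸ 1)) + ((if isNode r then 1 else 0) + (size r ∸ 1))
    -- A nonempty child contributes the edge leading to it and its own `size ∸ 1` edges; for an
    -- empty child, truncation gives 0.
    ≡⟨ cong₂ _+_ (size-pred l) (size-pred r) ⟩
  size l + size r ∎
  where
  open ≡-Reasoning
  l′ r′ : Tree
  l′ = mirror l
  r′ = mirror r
  F G : Tree → Tree → ℕ
  F = forkWeight (indicator false)
  G = forkWeight (indicator true)
  weights : ∀ l r → F l r + G l r ≡ (if isNode l then 1 else 0)
  weights nil        r          = refl
  weights (node _ _) nil        = refl
  weights (node _ _) (node _ _) = refl
  size-pred : ∀ t → (if isNode t then 1 else 0) + (size t ∸ 1) ≡ size t
  size-pred nil        = refl
  size-pred (node _ _) = refl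
  regroup : ∀ a b c d e f a′ b′ c′ d′ e′ f′ →
    (a + b + c + (d + e + f)) + (a′ + b′ + c′ + (d′ + e′ + f′)) ≡
    (a + d + (b + e + (c′ + f′))) + (a′ + d′ + (c + f + (b′ + e′)))
  regroup = solve-∀

-- Monomials and sums in a commutative ring

module _ {a ℓ} (R : CommutativeRing a ℓ) where
  open CommutativeRing R using (Carrier; _≈_; 0#; 1#; semiring; commutativeSemiring; +-isCommutativeMonoid;
      isEquivalence; zeroʳ; distribˡ; +-cong; *-cong; *-congˡ; *-congʳ)
    renaming (_+_ to _⊕_; _*_ to _⊗_; setoid to setoidᴿ; refl to ≈-refl; sym to ≈-sym; trans to ≈-trans;
      *-assoc to ⊗-assoc; *-comm to ⊗-comm; *-identityˡ to ⊗-identityˡ)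
  open import Algebra.Properties.CommutativeSemiring.Exp commutativeSemiring using (^-distrib-*)
  open import Algebra.Properties.Semiring.Exp semiring using (_^_; ^-homo-*; ^-congˡ)
  import Data.List.Relation.Binary.Permutation.Setoid.Properties setoidᴿ as Permutation
  open import Relation.Binary.Reasoning.Setoid setoidᴿ

  ∑ : List Carrier → Carrier
  ∑ = foldr _⊕_ 0#

  ∑-↭ : ∀ {xs ys} → xs ↭ ys → ∑ xs ≈ ∑ ys
  ∑-↭ xs↭ys = Permutation.foldr-commMonoid +-isCommutativeMonoid (↭⇒↭ₛ′ isEquivalence xs↭ys)

  ∑-scale : ∀ {B : Set} {f g : B → Carrier} {s} {xs : List B} →
            All (λ x → f x ≈ s ⊗ g x) xs → ∑ (map f xs) ≈ s ⊗ ∑ (map g xs)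
  ∑-scale []         = ≈-sym (zeroʳ _)
  ∑-scale (eq ∷ eqs) = ≈-trans (+-cong eq (∑-scale eqs)) (≈-sym (distribˡ _ _ _))

  1^ : ∀ m → 1# ^ m ≈ 1#
  1^ zero    = ≈-refl
  1^ (suc m) = ≈-trans (⊗-identityˡ _) (1^ m)

  ^-inverse : ∀ {r r⁻¹} m → r ⊗ r⁻¹ ≈ 1# → (r ^ m) ⊗ (r⁻¹ ^ m) ≈ 1#
  ^-inverse {r} {r⁻¹} m eq = ≈-trans (≈-sym (^-distrib-* r r⁻¹ m)) (≈-trans (^-congˡ m eq) (1^ m))

  -- The left side carries `r` to the power `i + j`; multiplying it by `r ^ (i′ + j)` and the same
  -- power of `r⁻¹` provides the missing factors.
  monomial-symmetry : ∀ {r r⁻¹} β i i′ j → r ⊗ r⁻¹ ≈ 1# →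
    (r ^ i) ⊗ ((r ⊗ β) ^ j) ≈ (r ^ (i + j + (i′ + j))) ⊗ ((r⁻¹ ^ i′) ⊗ ((β ⊗ r⁻¹) ^ j))
  monomial-symmetry {r} {r⁻¹} β i i′ j inv = begin
    (r ^ i) ⊗ ((r ⊗ β) ^ j)                                 ≈⟨ *-congˡ (^-distrib-* r β j) ⟩
    (r ^ i) ⊗ ((r ^ j) ⊗ (β ^ j))                           ≈⟨ ⊗-assoc _ _ _ ⟨
    (r ^ i) ⊗ (r ^ j) ⊗ (β ^ j)                             ≈⟨ *-congʳ (^-homo-* r i j) ⟨
    (r ^ (i + j)) ⊗ (β ^ j)                                 ≈⟨ *-congˡ (⊗-identityˡ _) ⟨
    (r ^ (i + j)) ⊗ (1# ⊗ (β ^ j))                          ≈⟨ *-congˡ (*-congʳ (^-inverse (i′ + j) inv)) ⟨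
    (r ^ (i + j)) ⊗ ((r ^ (i′ + j)) ⊗ (r⁻¹ ^ (i′ + j)) ⊗ (β ^ j)) ≈⟨ *-congˡ (⊗-assoc _ _ _) ⟩
    (r ^ (i + j)) ⊗ ((r ^ (i′ + j)) ⊗ ((r⁻¹ ^ (i′ + j)) ⊗ (β ^ j))) ≈⟨ ⊗-assoc _ _ _ ⟨
    (r ^ (i + j)) ⊗ (r ^ (i′ + j)) ⊗ ((r⁻¹ ^ (i′ + j)) ⊗ (β ^ j)) ≈⟨ *-cong (≈-sym (^-homo-* r (i + j) (i′ + j))) (*-congʳ (^-homo-* r⁻¹ i′ j)) ⟩
    (r ^ (i + j + (i′ + j))) ⊗ ((r⁻¹ ^ i′) ⊗ (r⁻¹ ^ j) ⊗ (β ^ j)) ≈⟨ *-congˡ (⊗-assoc _ _ _) ⟩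
    (r ^ (i + j + (i′ + j))) ⊗ ((r⁻¹ ^ i′) ⊗ ((r⁻¹ ^ j) ⊗ (β ^ j))) ≈⟨ *-congˡ (*-congˡ (⊗-comm _ _)) ⟩
    (r ^ (i + j + (i′ + j))) ⊗ ((r⁻¹ ^ i′) ⊗ ((β ^ j) ⊗ (r⁻¹ ^ j))) ≈⟨ *-congˡ (*-congˡ (^-distrib-* β r⁻¹ j)) ⟨
    (r ^ (i + j + (i′ + j))) ⊗ ((r⁻¹ ^ i′) ⊗ ((β ⊗ r⁻¹) ^ j)) ∎

  monomial : ℕ → Carrier → Carrier → Word → Carrier
  monomial n r b w = (r ^ Cr n w) ⊗ (b ^ Cb n w)

  monomial-reflect : ∀ {r r⁻¹} b → r ⊗ r⁻¹ ≈ 1# → IsDyck n w →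
    monomial n r (r ⊗ b) w ≈ (r ^ (n ∸ 1)) ⊗ monomial n r⁻¹ (b ⊗ r⁻¹) (reflect w)
  monomial-reflect {n} {w} {r} {r⁻¹} b inv d = begin
    monomial n r (r ⊗ b) w
      -- `Cr` and `Cb` unfold to `inDegree false` and `inDegree true`.
      ≡⟨ cong₂ (λ i j → (r ^ i) ⊗ ((r ⊗ b) ^ j)) (inDegree-tree false d) (inDegree-tree true d) ⟩
    (r ^ i) ⊗ ((r ⊗ b) ^ j)
      ≈⟨ monomial-symmetry b i i′ j inv ⟩
    (r ^ (i + j + (i′ + j))) ⊗ ((r⁻¹ ^ i′) ⊗ ((b ⊗ r⁻¹) ^ j))
      ≡⟨ cong₂ (λ e j → (r ^ e) ⊗ ((r⁻¹ ^ i′) ⊗ ((b ⊗ r⁻¹) ^ j))) exponent (sym (blues-mirror (tree w))) ⟩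
    (r ^ (n ∸ 1)) ⊗ ((r⁻¹ ^ i′) ⊗ ((b ⊗ r⁻¹) ^ blues (mirror (tree w))))
      ≡⟨ cong₂ (λ i j → (r ^ (n ∸ 1)) ⊗ ((r⁻¹ ^ i) ⊗ ((b ⊗ r⁻¹) ^ j))) (inDegree-reflect false d) (inDegree-reflect true d) ⟨
    (r ^ (n ∸ 1)) ⊗ monomial n r⁻¹ (b ⊗ r⁻¹) (reflect w)
      ∎
    where
    i i′ j : ℕ
    i  = reds (tree w)
    i′ = reds (mirror (tree w))
    j  = blues (tree w)
    exponent : i + j + (i′ + j) ≡ n ∸ 1
    exponent = trans (cong (λ e → i + j + (i′ + e)) (sym (blues-mirror (tree w))))
      (trans (forks+forks-mirror (tree w)) (cong (_∸ 1) (size-tree d)))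

mainTheorem4 :
    ∀ {c ℓ : Level} (R : CommutativeRing c ℓ) →
    let open CommutativeRing R
        open Algebra.Properties.Semiring.Exp semiring
    in (n : ℕ) → 1 ≤ n →
       (r r⁻¹ b : Carrier) → r * r⁻¹ ≈ 1# →
       A R n r (r * b) ≈ (r ^ (n ∸ 1)) * A R n r⁻¹ (b * r⁻¹)
mainTheorem4 R n _ r r⁻¹ b inv = begin
  ∑ R (map (monomial R n r (r ⊗ b)) ws)
    ≈⟨ ∑-scale R (All.tabulate (λ w∈ → monomial-reflect R b inv (∈-dyckPaths⁻ n w∈))) ⟩
  (r ^ (n ∸ 1)) ⊗ ∑ R (map (g ∘ reflect) ws)
    ≡⟨ cong (λ xs → (r ^ (n ∸ 1)) ⊗ ∑ R xs) (map-∘ ws) ⟩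
  (r ^ (n ∸ 1)) ⊗ ∑ R (map g (map reflect ws))
    -- Summing over reflected words only reorders the terms.
    ≈⟨ *-congˡ (∑-↭ R (map⁺ g (reflect-permutes n))) ⟩
  (r ^ (n ∸ 1)) ⊗ ∑ R (map g ws) ∎
  where
  open CommutativeRing R using (Carrier; semiring; *-congˡ) renaming (_*_ to _⊗_; setoid to setoidᴿ)
  open Algebra.Properties.Semiring.Exp semiring
  open import Relation.Binary.Reasoning.Setoid setoidᴿ
  ws : List Word
  ws = dyckPaths n
  g : Word → Carrier
  g = monomial R n r⁻¹ (b ⊗ r⁻¹)
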